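{- For $d\ge1$, let $a$ be the level-$2d$ uniform truncated strategy, i.e. $a_i=\frac12$ for $0\le i<2d$ and $a_i=0$ for $i\ge 2d$. Then $$U_{d,2d}(a)=O(d^2),$$ i.e. there is a constant $C$ such that $U_{d,2d}(a)\le C\,d^2$ for every integer $d\ge1$.
   Context: Fix integers $d\ge1$, $n\ge d$ and $a=(a_1,\dots,a_{n-1})\in[0,1]^{n-1}$. Set $a_0=\frac12$, $a_i=0$ for $i\ge n$, and let $(b_i)_{i\in\mathbb Z}$ be given by $b_i=a_i$ for $i\ge0$ and $b_i=1-a_{ -i}$ for $i<0$. The level-$n$ truncated chain is the Markov chain with states $S_{x,y}$, $x,y\in\mathbb Z$, $-n\le x,y\le n$, $x-y\le 2d$, $x-y$ even; states with $x-y=2d$ are absorbing; from any other state $S_{x,y}$ the two coordinates move independently, $x\mapsto x+1$ with probability $b_x$ and $x\mapsto x-1$ with probability $1-b_x$, and $y\mapsto y+1$ with probability $b_y$ and $y\mapsto y-1$ with probability $1-b_y$. $U_{d,n}(a)\in[0,\infty]$ is the expected hitting time of the absorbing set starting from $S_{0,0}$ ($\infty$ if not finite). -}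

module Defs where

open import Data.Bool using (if_then_else_)
open import Data.Fin using (Fin; fromℕ<)
open import Data.Integer as ℤ using (ℤ; +_; -[1+_])
import Data.Integer.Properties as ℤ
open import Data.Integer.Divisibility.Signed using (_∣_; divides)
open import Data.Integer.Tactic.RingSolver using (solve-∀)
open import Data.List using (List; []; _∷_; map; concatMap; foldr)
open import Data.List.Relation.Unary.All using (All; []; _∷_)
open import Data.Nat as ℕ using (ℕ; zero; suc; pred; s≤s)
import Data.Nat.Properties as ℕ
open import Data.Product using (_×_; _,_; ∃-syntax; proj₁; proj₂)
open import Data.Rational as ℚ using (ℚ; 0ℚ; 1ℚ; ½)
import Data.Rational.Properties as ℚ
open import Data.Sum using (_⊎_; inj₁; inj₂)
open import Data.Vec using (Vec; []; _∷_)
open import Function using (const)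
open import Relation.Binary.PropositionalEquality
  using (_≡_; refl; sym; trans; cong; subst; subst₂)
open import Relation.Nullary using (Dec; yes; no; does; ¬_; contradiction)
open import Relation.Nullary.Decidable using (from-yes)

-- Elements of (-∞,∞], given by the rationals strictly below them;
-- ∞ is the cut containing every rational.

record LowerReal : Set₁ where
  field
    below : ℚ → Set
    down  : ∀ {p q} → p ℚ.< q → below q → below p
    open′ : ∀ {p} → below p → ∃[ q ] p ℚ.< q × below q

open LowerReal public

infix 4 _≤ᴸ_

_≤ᴸ_ : LowerReal → LowerReal → Set
x ≤ᴸ y = ∀ q → below x q → below y q

fromℚ : ℚ → LowerReal
fromℚ r = record
  { below = ℚ._< r
  ; down  = ℚ.<-trans
  ; open′ = λ p<r → let q , p<q , q<r = ℚ.<-dense p<r in q , p<q , q<r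
  }

sup : (ℕ → ℚ) → LowerReal
sup s = record
  { below = λ q → ∃[ N ] q ℚ.< s N
  ; down  = λ p<q (N , q<s) → N , ℚ.<-trans p<q q<s
  ; open′ = λ (N , p<s) → let q , p<q , q<s = ℚ.<-dense p<s in q , p<q , N , q<s
  }

-- Finitely supported distributions, as lists of (probability , outcome).
-- An outcome may be listed several times; its probabilities then add up.

Dist : Set → Set
Dist A = List (ℚ × A)

return : ∀ {A} → A → Dist A
return x = (1ℚ , x) ∷ []

infixl 1 _>>=_

_>>=_ : ∀ {A B} → Dist A → (A → Dist B) → Dist B
μ >>= f = concatMap (λ (p , x) → map (λ (q , y) → p ℚ.* q , y) (f x)) μ

𝔼 : ∀ {A} → Dist A → (A → ℚ) → ℚ
𝔼 μ f = foldr (λ (p , x) r → p ℚ.* f x ℚ.+ r) 0ℚ μ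

fromℕ : ℕ → ℚ
fromℕ k = + k ℚ./ 1

-- (a₁ , … , aₙ₋₁); the entry at index j : Fin (n - 1) is aⱼ₊₁.
-- Entries are rational rather than real, which suffices for uniform.

record Strategy (n : ℕ) : Set where
  field
    entry   : Fin (pred n) → ℚ
    entry≥0 : ∀ j → 0ℚ ℚ.≤ entry j
    entry≤1 : ∀ j → entry j ℚ.≤ 1ℚ

open Strategy public

uniform : ∀ n → Strategy n
uniform n = record
  { entry   = const ½
  ; entry≥0 = const (from-yes (0ℚ ℚ.≤? ½))
  ; entry≤1 = const (from-yes (½ ℚ.≤? 1ℚ))
  }

module _ {n : ℕ} (a : Strategy n) where

  coeff : ℕ → ℚ
  coeff zero = ½
  coeff (suc j) with j ℕ.<? pred n
  ... | yes j<n-1 = entry a (fromℕ< j<n-1)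
  ... | no  _     = 0ℚ

  bias : ℤ → ℚ
  bias (+ i)    = coeff i
  bias -[1+ i ] = 1ℚ ℚ.- coeff (suc i)

  move : ℤ → Dist ℤ
  move x = (bias x , x ℤ.+ + 1) ∷ (1ℚ ℚ.- bias x , x ℤ.- + 1) ∷ []

-- The pair (x , y) stands for S_{x,y}.  The kernel is defined on all of
-- ℤ × ℤ; the actual state space is IsState, and step-closed shows that
-- a move leaving it has probability 0.

State : Set
State = ℤ × ℤ

record IsState (d n : ℕ) (s : State) : Set where
  constructor isState
  x = proj₁ s
  y = proj₂ s
  field
    x≥-n  : ℤ.- (+ n) ℤ.≤ x
    x≤n   : x ℤ.≤ + n
    y≥-n  : ℤ.- (+ n) ℤ.≤ y
    y≤n   : y ℤ.≤ + n
    x-y≤  : x ℤ.- y ℤ.≤ + (2 ℕ.* d)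
    even  : + 2 ∣ x ℤ.- y

Absorbing : ℕ → State → Set
Absorbing d (x , y) = x ℤ.- y ≡ + (2 ℕ.* d)

absorbing? : ∀ d s → Dec (Absorbing d s)
absorbing? d (x , y) = x ℤ.- y ℤ.≟ + (2 ℕ.* d)

module _ (d : ℕ) {n : ℕ} (a : Strategy n) where

  step : State → Dist State
  step s@(x , y) =
    if does (absorbing? d s)
    then return s
    else (move a x >>= λ x′ → move a y >>= λ y′ → return (x′ , y′))

  -- The law of (X₀ , … , X_{N-1}) for the chain started at X₀ = s.
  trajectory : ∀ N → State → Dist (Vec State N)
  trajectory zero    s = return []
  trajectory (suc N) s =
    step s >>= λ s′ → trajectory N s′ >>= λ ss → return (s ∷ ss)

-- The number of states before the first absorbing one.  On
-- (X₀ , … , X_{N-1}) this is min(T , N), T being the hitting time.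

hittingTime : ∀ (d : ℕ) {N} → Vec State N → ℕ
hittingTime d []       = 0
hittingTime d (s ∷ ss) =
  if does (absorbing? d s) then 0 else suc (hittingTime d ss)

-- 𝔼[T] = sup_N 𝔼[min(T , N)], also when T = ∞ with positive probability.
-- This is the intended quantity for d ≥ 1 and n ≥ d.

U : (d n : ℕ) → Strategy n → LowerReal
U d n a = sup λ N →
  𝔼 (trajectory d a N (+ 0 , + 0)) (λ ss → fromℕ (hittingTime d ss))

private
  twice : ∀ d → + (2 ℕ.* d) ≡ + d ℤ.* + 2
  twice d = trans (cong +_ (ℕ.*-comm 2 d)) (ℤ.pos-* d 2)

  module _ {m : ℕ} (a : Strategy (suc m)) where

    n = suc m

    coeff-n : coeff a n ≡ 0ℚ
    coeff-n with m ℕ.<? m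
    ... | yes m<m = contradiction m<m (ℕ.<-irrefl refl)
    ... | no  _   = refl

    InRange : ℤ → Set
    InRange x = ℤ.- (+ n) ℤ.≤ x × x ℤ.≤ + n

    up : ∀ {x} → InRange x → bias a x ≡ 0ℚ ⊎ InRange (x ℤ.+ + 1)
    up {x} (l , u) with x ℤ.≟ + n
    ... | yes refl = inj₁ coeff-n
    ... | no  x≢n  = inj₂
      ( ℤ.≤-trans l (ℤ.i≤i+j x (+ 1))
      , subst (ℤ._≤ + n) (ℤ.+-comm (+ 1) x) (ℤ.i<j⇒suc[i]≤j (ℤ.≤∧≢⇒< u x≢n)))

    down₁ : ∀ {x} → InRange x → 1ℚ ℚ.- bias a x ≡ 0ℚ ⊎ InRange (x ℤ.- + 1)
    down₁ {x} (l , u) with ℤ.- (+ n) ℤ.≟ x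
    ... | yes refl = inj₁ (cong (λ c → 1ℚ ℚ.- (1ℚ ℚ.- c)) coeff-n)
    ... | no  -n≢x = inj₂
      ( subst (ℤ.- (+ n) ℤ.≤_) (ℤ.+-comm ℤ.-1ℤ x) (ℤ.i<j⇒i≤pred[j] (ℤ.≤∧≢⇒< l -n≢x))
      , ℤ.i≤j⇒i-k≤j (+ 1) u)

    both : ∀ {d p q x′ y′} k → p ≡ 0ℚ ⊎ InRange x′ → q ≡ 0ℚ ⊎ InRange y′ →
           x′ ℤ.- y′ ≡ k ℤ.* + 2 → k ℤ.≤ + d →
           p ℚ.* (q ℚ.* 1ℚ) ≡ 0ℚ ⊎ IsState d n (x′ , y′)
    both {q = q} k (inj₁ refl) _ _ _ = inj₁ (ℚ.*-zeroˡ (q ℚ.* 1ℚ))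
    both {p = p} k (inj₂ _) (inj₁ refl) _ _ = inj₁ (ℚ.*-zeroʳ p)
    both {d} k (inj₂ (lx , ux)) (inj₂ (ly , uy)) eq k≤d = inj₂ (isState lx ux ly uy
      (subst₂ ℤ._≤_ (sym eq) (sym (twice d)) (ℤ.*-monoʳ-≤-nonNeg (+ 2) k≤d))
      (divides k eq))

  shift : ∀ k c {z z′} → z ≡ k ℤ.* + 2 → z′ ≡ z ℤ.+ c ℤ.* + 2 → z′ ≡ (k ℤ.+ c) ℤ.* + 2
  shift k c refl eq = trans eq (sym (ℤ.*-distribʳ-+ (+ 2) k c))

  half< : ∀ d k {z} → z ≡ k ℤ.* + 2 → z ℤ.≤ + (2 ℕ.* d) → ¬ z ≡ + (2 ℕ.* d) → k ℤ.< + d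
  half< d k refl z≤ z≢ = ℤ.*-cancelʳ-<-nonNeg {k} {+ d} (+ 2)
    (subst (k ℤ.* + 2 ℤ.<_) (twice d) (ℤ.≤∧≢⇒< z≤ z≢))

  uu : ∀ x y → (x ℤ.+ + 1) ℤ.- (y ℤ.+ + 1) ≡ (x ℤ.- y) ℤ.+ + 0 ℤ.* + 2
  uu = solve-∀
  ud : ∀ x y → (x ℤ.+ + 1) ℤ.- (y ℤ.- + 1) ≡ (x ℤ.- y) ℤ.+ + 1 ℤ.* + 2
  ud = solve-∀
  du : ∀ x y → (x ℤ.- + 1) ℤ.- (y ℤ.+ + 1) ≡ (x ℤ.- y) ℤ.+ ℤ.-1ℤ ℤ.* + 2
  du = solve-∀
  dd : ∀ x y → (x ℤ.- + 1) ℤ.- (y ℤ.- + 1) ≡ (x ℤ.- y) ℤ.+ + 0 ℤ.* + 2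
  dd = solve-∀

step-closed : ∀ d {n} (a : Strategy n) → n ℕ.≥ 1 → ∀ {s} → IsState d n s →
              All (λ (p , s′) → p ≡ 0ℚ ⊎ IsState d n s′) (step d a s)
step-closed d {suc m} a _ {s@(x , y)} st@(isState lx ux ly uy x-y≤ (divides k eq))
  with absorbing? d s
... | yes _   = inj₂ st ∷ []
... | no  ¬ab =
    both a _ (up a rx)    (up a ry)    (shift k (+ 0) eq (uu x y)) k+0≤d
  ∷ both a _ (up a rx)    (down₁ a ry) (shift k (+ 1) eq (ud x y)) k+1≤d
  ∷ both a _ (down₁ a rx) (up a ry)    (shift k ℤ.-1ℤ eq (du x y)) k-1≤d
  ∷ both a _ (down₁ a rx) (down₁ a ry) (shift k (+ 0) eq (dd x y)) k+0≤d
  ∷ []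
  where
  rx : InRange a x
  rx = lx , ux
  ry : InRange a y
  ry = ly , uy
  k+1≤d : k ℤ.+ + 1 ℤ.≤ + d
  k+1≤d = subst (ℤ._≤ + d) (ℤ.+-comm (+ 1) k)
    (ℤ.i<j⇒suc[i]≤j (half< d k eq x-y≤ ¬ab))
  k+0≤d : k ℤ.+ + 0 ℤ.≤ + d
  k+0≤d = ℤ.≤-trans (ℤ.+-monoʳ-≤ k (ℤ.+≤+ ℕ.z≤n)) k+1≤d
  k-1≤d : k ℤ.- + 1 ℤ.≤ + d
  k-1≤d = ℤ.≤-trans (ℤ.+-monoʳ-≤ k ℤ.-≤+) k+1≤d

{-# OPTIONS --safe #-}

-- With n = 2d, the function V = lyapunov n below is nonnegative on the
-- states and drops by at least 2n² in expectation at every non-absorbing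
-- step, so 2n² 𝔼[T] ≤ V(0,0) = 70n⁴ + 8n² (Foster's criterion).  In
-- p = x + y and r = x - y + 2n the walk moves one of the two coordinates
-- by ±2.  V is a quartic whose interior drift is exactly -2n², and whose
-- remaining coefficients are chosen so that V still drops after a reflection
-- at the sides x = ±n, y = ±n.

module Submission where

open import Defs
open import Algebra.Bundles using (CommutativeMonoid)
open import Data.Empty using (⊥)
open import Data.Fin.Patterns using (0F; 1F; 2F; 3F; 4F; 5F; 6F; 7F; 8F; 9F)
open import Data.Integer as ℤ using (ℤ; +_; -[1+_]; +≤+; -<-; +<+)
open import Data.Integer.Divisibility.Signed using (divides)
import Data.Integer.Properties as ℤ
import Data.Integer.Solver as ℤSolver
open import Data.List using ([]; _∷_; _++_; map)
open import Data.List.Relation.Unary.All using (All; []; _∷_)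
open import Data.List.Relation.Unary.All.Properties using (++⁺)
open import Data.Nat as ℕ using (ℕ; suc; zero; _≥_; _*_; s≤s; z≤n)
import Data.Nat.Properties as ℕ
open import Data.Product using (∃-syntax; _×_; _,_)
open import Data.Rational as ℚ using (ℚ; 0ℚ; 1ℚ; ½)
import Data.Rational.Properties as ℚ
open import Data.Rational.Unnormalised as ℚᵘ using (mkℚᵘ; *≡*; *≤*)
import Data.Rational.Unnormalised.Properties as ℚᵘ
open import Data.Sum using (_⊎_; inj₁; inj₂)
open import Data.Unit using (⊤)
open import Data.Vec using (Vec; []; _∷_)
open import Data.Vec.Relation.Unary.All as Allᵛ using ([]; _∷_)
open import Data.Vec.Relation.Unary.All.Properties using (lookup⁺)
open import Relation.Binary.PropositionalEquality
  using (_≡_; refl; sym; trans; cong; cong₂; subst; module ≡-Reasoning)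
open import Relation.Nullary using (Dec; ¬_; yes; no; contradiction)
open import Relation.Nullary.Decidable using (from-yes)

open import Algebra.Definitions.RawSemiring ℤ.+-*-rawSemiring using (_^_)

-- Expectations

𝔼-cong : ∀ {A} (μ : Dist A) {f g : A → ℚ} → (∀ x → f x ≡ g x) → 𝔼 μ f ≡ 𝔼 μ g
𝔼-cong []            f≗g = refl
𝔼-cong ((p , x) ∷ μ) f≗g = cong₂ (λ u v → p ℚ.* u ℚ.+ v) (f≗g x) (𝔼-cong μ f≗g)

𝔼-++ : ∀ {A} (μ ν : Dist A) (f : A → ℚ) → 𝔼 (μ ++ ν) f ≡ 𝔼 μ f ℚ.+ 𝔼 ν f
𝔼-++ []            ν f = sym (ℚ.+-identityˡ (𝔼 ν f))
𝔼-++ ((p , x) ∷ μ) ν f =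
  trans (cong (p ℚ.* f x ℚ.+_) (𝔼-++ μ ν f))
        (sym (ℚ.+-assoc (p ℚ.* f x) (𝔼 μ f) (𝔼 ν f)))

𝔼-scale : ∀ {A} p (μ : Dist A) (f : A → ℚ) →
          𝔼 (map (λ (q , x) → p ℚ.* q , x) μ) f ≡ p ℚ.* 𝔼 μ f
𝔼-scale p []            f = sym (ℚ.*-zeroʳ p)
𝔼-scale p ((q , x) ∷ μ) f =
  trans (cong₂ ℚ._+_ (ℚ.*-assoc p q (f x)) (𝔼-scale p μ f))
        (sym (ℚ.*-distribˡ-+ p (q ℚ.* f x) (𝔼 μ f)))

𝔼-return : ∀ {A} (x : A) (f : A → ℚ) → 𝔼 (return x) f ≡ f x
𝔼-return x f = trans (ℚ.+-identityʳ (1ℚ ℚ.* f x)) (ℚ.*-identityˡ (f x))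

𝔼->>= : ∀ {A B} (μ : Dist A) (k : A → Dist B) (f : B → ℚ) →
        𝔼 (μ >>= k) f ≡ 𝔼 μ (λ x → 𝔼 (k x) f)
𝔼->>= []            k f = refl
𝔼->>= ((p , x) ∷ μ) k f =
  trans (𝔼-++ (map (λ (q , y) → p ℚ.* q , y) (k x)) (μ >>= k) f)
        (cong₂ ℚ._+_ (𝔼-scale p (k x) f) (𝔼->>= μ k f))

𝔼-× : ∀ {A B} (μ : Dist A) (ν : Dist B) (f : A × B → ℚ) →
      𝔼 (μ >>= λ x → ν >>= λ y → return (x , y)) f ≡ 𝔼 μ λ x → 𝔼 ν λ y → f (x , y)
𝔼-× μ ν f =
  trans (𝔼->>= μ (λ x → ν >>= λ y → return (x , y)) f) (𝔼-cong μ λ x →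
  trans (𝔼->>= ν (λ y → return (x , y)) f) (𝔼-cong ν λ y → 𝔼-return (x , y) f))

𝔼-+ : ∀ {A} (μ : Dist A) (f g : A → ℚ) →
      𝔼 μ (λ x → f x ℚ.+ g x) ≡ 𝔼 μ f ℚ.+ 𝔼 μ g
𝔼-+ []            f g = refl
𝔼-+ ((p , x) ∷ μ) f g = trans
  (cong₂ ℚ._+_ (ℚ.*-distribˡ-+ p (f x) (g x)) (𝔼-+ μ f g))
  (interchange (p ℚ.* f x) (p ℚ.* g x) (𝔼 μ f) (𝔼 μ g))
  where
  open import Algebra.Properties.CommutativeSemigroup
    (CommutativeMonoid.commutativeSemigroup ℚ.+-0-commutativeMonoid) using (interchange)

𝔼-* : ∀ {A} c (μ : Dist A) (f : A → ℚ) → 𝔼 μ (λ x → c ℚ.* f x) ≡ c ℚ.* 𝔼 μ f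
𝔼-* c []            f = sym (ℚ.*-zeroʳ c)
𝔼-* c ((p , x) ∷ μ) f = trans
  (cong₂ ℚ._+_ (x∙yz≈y∙xz p c (f x)) (𝔼-* c μ f))
  (sym (ℚ.*-distribˡ-+ c (p ℚ.* f x) (𝔼 μ f)))
  where
  open import Algebra.Properties.CommutativeSemigroup
    (CommutativeMonoid.commutativeSemigroup ℚ.*-1-commutativeMonoid) using (x∙yz≈y∙xz)

NonNegWeights : ∀ {A} → Dist A → Set
NonNegWeights = All λ (p , _) → 0ℚ ℚ.≤ p

-- Outcomes of weight zero are exempt from the comparison. This matches the form of `step-closed`:
-- the kernel also lists moves that leave the state space, and those carry weight 0.
𝔼-mono : ∀ {A} {μ : Dist A} {P : A → Set} {f g : A → ℚ} →
         NonNegWeights μ → All (λ (p , x) → p ≡ 0ℚ ⊎ P x) μ →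
         (∀ {x} → P x → f x ℚ.≤ g x) → 𝔼 μ f ℚ.≤ 𝔼 μ g
𝔼-mono []           []                 f≤g = ℚ.≤-refl
𝔼-mono {μ = (_ , x) ∷ _} {f = f} {g} (0≤p ∷ 0≤ps) (inj₁ refl ∷ ps) f≤g =
  ℚ.+-mono-≤ (ℚ.≤-reflexive (trans (ℚ.*-zeroˡ (f x)) (sym (ℚ.*-zeroˡ (g x)))))
             (𝔼-mono 0≤ps ps f≤g)
𝔼-mono {μ = (p , _) ∷ _} (0≤p ∷ 0≤ps) (inj₂ Px ∷ ps) f≤g =
  ℚ.+-mono-≤ (ℚ.*-monoˡ-≤-nonNeg p {{ℚ.nonNegative 0≤p}} (f≤g Px))
             (𝔼-mono 0≤ps ps f≤g)

0≤p*q : ∀ {p q} → 0ℚ ℚ.≤ p → 0ℚ ℚ.≤ q → 0ℚ ℚ.≤ p ℚ.* q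
0≤p*q {p} {q} 0≤p 0≤q = ℚ.nonNegative⁻¹ (p ℚ.* q)
  {{ℚ.nonNeg*nonNeg⇒nonNeg p {{ℚ.nonNegative 0≤p}} q {{ℚ.nonNegative 0≤q}}}}

return-nonNeg : ∀ {A} (x : A) → NonNegWeights (return x)
return-nonNeg x = ℚ.nonNegative⁻¹ 1ℚ ∷ []

>>=-nonNeg : ∀ {A B} {μ : Dist A} {k : A → Dist B} →
             NonNegWeights μ → (∀ x → NonNegWeights (k x)) →
             NonNegWeights (μ >>= k)
>>=-nonNeg []           0≤k = []
>>=-nonNeg {A} {B} {μ = (p , x) ∷ _} (0≤p ∷ 0≤ps) 0≤k =
  ++⁺ (scale (0≤k x)) (>>=-nonNeg 0≤ps 0≤k)
  where
  scale : {ν : Dist B} → NonNegWeights ν →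
          NonNegWeights (map (λ (q , y) → p ℚ.* q , y) ν)
  scale []           = []
  scale (0≤q ∷ 0≤qs) = 0≤p*q 0≤p 0≤q ∷ scale 0≤qs

-- The embedding of ℤ into ℚ

-- On `+ k` this is `fromℕ k` by definition, so hitting times lie in its image. The polynomial
-- estimates can then be carried out in ℤ, where the ring solver applies.
ι : ℤ → ℚ
ι i = i ℚ./ 1

toℚᵘ-ι : ∀ i → ℚ.toℚᵘ (ι i) ℚᵘ.≃ mkℚᵘ i 0
toℚᵘ-ι i = ℚ.toℚᵘ-fromℚᵘ (mkℚᵘ i 0)

-- The quotient `i / 1` is normalised, so the identity is checked on unnormalised fractions, where
-- all denominators are 1.
ι-+ : ∀ i j → ι (i ℤ.+ j) ≡ ι i ℚ.+ ι j
ι-+ i j = ℚ.toℚᵘ-injective (begin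
  ℚ.toℚᵘ (ι (i ℤ.+ j))              ≈⟨ toℚᵘ-ι (i ℤ.+ j) ⟩
  mkℚᵘ (i ℤ.+ j) 0                  ≈⟨ *≡* (cong (ℤ._* + 1) (cong₂ ℤ._+_ (ℤ.*-identityʳ i) (ℤ.*-identityʳ j))) ⟨
  mkℚᵘ i 0 ℚᵘ.+ mkℚᵘ j 0            ≈⟨ ℚᵘ.+-cong (toℚᵘ-ι i) (toℚᵘ-ι j) ⟨
  ℚ.toℚᵘ (ι i) ℚᵘ.+ ℚ.toℚᵘ (ι j)    ≈⟨ ℚ.toℚᵘ-homo-+ (ι i) (ι j) ⟨
  ℚ.toℚᵘ (ι i ℚ.+ ι j)              ∎)
  where open ℚᵘ.≃-Reasoning

ι-* : ∀ i j → ι (i ℤ.* j) ≡ ι i ℚ.* ι j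
ι-* i j = ℚ.toℚᵘ-injective (begin
  ℚ.toℚᵘ (ι (i ℤ.* j))              ≈⟨ toℚᵘ-ι (i ℤ.* j) ⟩
  mkℚᵘ i 0 ℚᵘ.* mkℚᵘ j 0            ≈⟨ ℚᵘ.*-cong (toℚᵘ-ι i) (toℚᵘ-ι j) ⟨
  ℚ.toℚᵘ (ι i) ℚᵘ.* ℚ.toℚᵘ (ι j)    ≈⟨ ℚ.toℚᵘ-homo-* (ι i) (ι j) ⟨
  ℚ.toℚᵘ (ι i ℚ.* ι j)              ∎)
  where open ℚᵘ.≃-Reasoning

ι-mono-≤ : ∀ {i j} → i ℤ.≤ j → ι i ℚ.≤ ι j
ι-mono-≤ {i} {j} i≤j = ℚ.toℚᵘ-cancel-≤
  (ℚᵘ.≤-respˡ-≃ (ℚᵘ.≃-sym (toℚᵘ-ι i)) (ℚᵘ.≤-respʳ-≃ (ℚᵘ.≃-sym (toℚᵘ-ι j))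
    (*≤* (ℤ.*-monoʳ-≤-nonNeg (+ 1) i≤j))))

ι-pos : ∀ i → .{{ℤ.Positive i}} → ℚ.Positive (ι i)
ι-pos (+ suc k) = ℚ.normalize-pos (suc k) 1

-- Clears the factor ½ of a fair move, so that a drift bound becomes an inequality between integers.
-- Using it once per coordinate handles the four moves of an interior state.
½*-≤ι : ∀ {p} c → p ℚ.≤ ι (+ 2 ℤ.* c) → ½ ℚ.* p ℚ.≤ ι c
½*-≤ι {p} c p≤2c = begin
  ½ ℚ.* p                    ≤⟨ ℚ.*-monoˡ-≤-nonNeg ½ p≤2c ⟩
  ½ ℚ.* ι (+ 2 ℤ.* c)        ≡⟨ cong (½ ℚ.*_) (ι-* (+ 2) c) ⟩
  ½ ℚ.* (ι (+ 2) ℚ.* ι c)    ≡⟨ ℚ.*-assoc ½ (ι (+ 2)) (ι c) ⟨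
  1ℚ ℚ.* ι c                 ≡⟨ ℚ.*-identityˡ (ι c) ⟩
  ι c                        ∎
  where open ℚ.≤-Reasoning

average₂ : ∀ a b {c} → a ℤ.+ b ℤ.≤ + 2 ℤ.* c → ½ ℚ.* (ι a ℚ.+ ι b) ℚ.≤ ι c
average₂ a b {c} a+b≤2c =
  ½*-≤ι c (subst (ℚ._≤ ι (+ 2 ℤ.* c)) (ι-+ a b) (ι-mono-≤ a+b≤2c))

average₄ : ∀ a b c d {e} → (a ℤ.+ b) ℤ.+ (c ℤ.+ d) ℤ.≤ + 2 ℤ.* (+ 2 ℤ.* e) →
           ½ ℚ.* (½ ℚ.* (ι a ℚ.+ ι b) ℚ.+ ½ ℚ.* (ι c ℚ.+ ι d)) ℚ.≤ ι e
average₄ a b c d {e} Σ≤4e = ½*-≤ι e (begin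
  ½ ℚ.* (ι a ℚ.+ ι b) ℚ.+ ½ ℚ.* (ι c ℚ.+ ι d)    ≡⟨ ℚ.*-distribˡ-+ ½ (ι a ℚ.+ ι b) (ι c ℚ.+ ι d) ⟨
  ½ ℚ.* ((ι a ℚ.+ ι b) ℚ.+ (ι c ℚ.+ ι d))        ≡⟨ cong (½ ℚ.*_) (cong₂ ℚ._+_ (ι-+ a b) (ι-+ c d)) ⟨
  ½ ℚ.* (ι (a ℤ.+ b) ℚ.+ ι (c ℤ.+ d))            ≤⟨ average₂ (a ℤ.+ b) (c ℤ.+ d) Σ≤4e ⟩
  ι (+ 2 ℤ.* e)                                  ∎)
  where open ℚ.≤-Reasoning

-- Trajectories and Foster's criterion

module _ {n : ℕ} (a : Strategy n) where

  0≤coeff : ∀ i → 0ℚ ℚ.≤ coeff a i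
  0≤coeff zero = ℚ.nonNegative⁻¹ ½
  0≤coeff (suc j) with j ℕ.<? ℕ.pred n
  ... | yes _ = entry≥0 a _
  ... | no  _ = ℚ.≤-refl

  coeff≤1 : ∀ i → coeff a i ℚ.≤ 1ℚ
  coeff≤1 zero = from-yes (½ ℚ.≤? 1ℚ)
  coeff≤1 (suc j) with j ℕ.<? ℕ.pred n
  ... | yes _ = entry≤1 a _
  ... | no  _ = ℚ.nonNegative⁻¹ 1ℚ

  0≤1-p : ∀ {p} → p ℚ.≤ 1ℚ → 0ℚ ℚ.≤ 1ℚ ℚ.- p
  0≤1-p {p} p≤1 = subst (ℚ._≤ 1ℚ ℚ.- p) (ℚ.+-inverseʳ p) (ℚ.+-monoˡ-≤ (ℚ.- p) p≤1)

  0≤bias : ∀ x → 0ℚ ℚ.≤ bias a x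
  0≤bias (+ i)    = 0≤coeff i
  0≤bias -[1+ i ] = 0≤1-p (coeff≤1 (suc i))

  bias≤1 : ∀ x → bias a x ℚ.≤ 1ℚ
  bias≤1 (+ i)    = coeff≤1 i
  bias≤1 -[1+ i ] = subst (1ℚ ℚ.- coeff a (suc i) ℚ.≤_) (ℚ.+-identityʳ 1ℚ)
    (ℚ.+-monoʳ-≤ 1ℚ (ℚ.neg-antimono-≤ (0≤coeff (suc i))))

  move-nonNeg : ∀ x → NonNegWeights (move a x)
  move-nonNeg x = 0≤bias x ∷ 0≤1-p (bias≤1 x) ∷ []

  𝔼-move-½ : ∀ {x} (f : ℤ → ℚ) → bias a x ≡ ½ →
             𝔼 (move a x) f ≡ ½ ℚ.* (f (x ℤ.+ + 1) ℚ.+ f (x ℤ.- + 1))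
  𝔼-move-½ {x} f eq rewrite eq = begin
    ½ ℚ.* f⁺ ℚ.+ (½ ℚ.* f⁻ ℚ.+ 0ℚ)    ≡⟨ cong (½ ℚ.* f⁺ ℚ.+_) (ℚ.+-identityʳ (½ ℚ.* f⁻)) ⟩
    ½ ℚ.* f⁺ ℚ.+ ½ ℚ.* f⁻             ≡⟨ ℚ.*-distribˡ-+ ½ f⁺ f⁻ ⟨
    ½ ℚ.* (f⁺ ℚ.+ f⁻)                 ∎
    where
    open ≡-Reasoning
    f⁺ = f (x ℤ.+ + 1)
    f⁻ = f (x ℤ.- + 1)

  𝔼-move-0 : ∀ {x} (f : ℤ → ℚ) → bias a x ≡ 0ℚ → 𝔼 (move a x) f ≡ f (x ℤ.- + 1)
  𝔼-move-0 {x} f eq rewrite eq = begin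
    0ℚ ℚ.* f⁺ ℚ.+ 𝔼 (return (x ℤ.- + 1)) f  ≡⟨ cong (ℚ._+ 𝔼 (return (x ℤ.- + 1)) f) (ℚ.*-zeroˡ f⁺) ⟩
    0ℚ ℚ.+ 𝔼 (return (x ℤ.- + 1)) f         ≡⟨ ℚ.+-identityˡ _ ⟩
    𝔼 (return (x ℤ.- + 1)) f                ≡⟨ 𝔼-return (x ℤ.- + 1) f ⟩
    f (x ℤ.- + 1)                           ∎
    where
    open ≡-Reasoning
    f⁺ = f (x ℤ.+ + 1)

  𝔼-move-1 : ∀ {x} (f : ℤ → ℚ) → bias a x ≡ 1ℚ → 𝔼 (move a x) f ≡ f (x ℤ.+ + 1)
  𝔼-move-1 {x} f eq rewrite eq = begin
    1ℚ ℚ.* f⁺ ℚ.+ (0ℚ ℚ.* f⁻ ℚ.+ 0ℚ)    ≡⟨ cong (λ z → 1ℚ ℚ.* f⁺ ℚ.+ (z ℚ.+ 0ℚ)) (ℚ.*-zeroˡ f⁻) ⟩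
    𝔼 (return (x ℤ.+ + 1)) f            ≡⟨ 𝔼-return (x ℤ.+ + 1) f ⟩
    f⁺                                  ∎
    where
    open ≡-Reasoning
    f⁺ = f (x ℤ.+ + 1)
    f⁻ = f (x ℤ.- + 1)

  𝔼-move-const : ∀ x c → 𝔼 (move a x) (λ _ → c) ≡ c
  𝔼-move-const x c = begin
    b ℚ.* c ℚ.+ ((1ℚ ℚ.- b) ℚ.* c ℚ.+ 0ℚ)  ≡⟨ cong (b ℚ.* c ℚ.+_) (ℚ.+-identityʳ _) ⟩
    b ℚ.* c ℚ.+ (1ℚ ℚ.- b) ℚ.* c           ≡⟨ ℚ.*-distribʳ-+ c b (1ℚ ℚ.- b) ⟨
    (b ℚ.+ (1ℚ ℚ.- b)) ℚ.* c               ≡⟨ cong (ℚ._* c) (ℚ.+-comm b (1ℚ ℚ.- b)) ⟩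
    (1ℚ ℚ.- b ℚ.+ b) ℚ.* c                 ≡⟨ cong (ℚ._* c) (ℚ.+-assoc 1ℚ (ℚ.- b) b) ⟩
    (1ℚ ℚ.+ (ℚ.- b ℚ.+ b)) ℚ.* c           ≡⟨ cong (λ z → (1ℚ ℚ.+ z) ℚ.* c) (ℚ.+-inverseˡ b) ⟩
    1ℚ ℚ.* c                               ≡⟨ ℚ.*-identityˡ c ⟩
    c                                      ∎
    where
    open ≡-Reasoning
    b = bias a x

module _ (d : ℕ) {n : ℕ} (a : Strategy n) where

  step-nonNeg : ∀ s → NonNegWeights (step d a s)
  step-nonNeg s@(x , y) with absorbing? d s
  ... | yes _ = return-nonNeg s
  ... | no  _ = >>=-nonNeg (move-nonNeg a x) λ x′ →
                >>=-nonNeg (move-nonNeg a y) λ y′ → return-nonNeg (x′ , y′)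

  𝔼-step : ∀ {x y} → ¬ Absorbing d (x , y) → (f : State → ℚ) →
           𝔼 (step d a (x , y)) f ≡ 𝔼 (move a x) λ x′ → 𝔼 (move a y) λ y′ → f (x′ , y′)
  𝔼-step {x} {y} ¬ab f with absorbing? d (x , y)
  ... | yes ab = contradiction ab ¬ab
  ... | no  _  = 𝔼-× (move a x) (move a y) f

  𝔼-step-const : ∀ s c → 𝔼 (step d a s) (λ _ → c) ≡ c
  𝔼-step-const s@(x , y) c with absorbing? d s
  ... | yes _ = 𝔼-return s (λ _ → c)
  ... | no  _ = trans (𝔼-× (move a x) (move a y) (λ _ → c))
    (trans (𝔼-cong (move a x) (λ _ → 𝔼-move-const a y c)) (𝔼-move-const a x c))

  𝔼-trajectory-suc : ∀ N s (f : Vec State (suc N) → ℚ) →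
    𝔼 (trajectory d a (suc N) s) f ≡
    𝔼 (step d a s) λ s′ → 𝔼 (trajectory d a N s′) λ ss → f (s ∷ ss)
  𝔼-trajectory-suc N s f =
    trans (𝔼->>= (step d a s) (λ s′ → trajectory d a N s′ >>= λ ss → return (s ∷ ss)) f)
      (𝔼-cong (step d a s) λ s′ →
    trans (𝔼->>= (trajectory d a N s′) (λ ss → return (s ∷ ss)) f) (𝔼-cong (trajectory d a N s′) λ ss →
    𝔼-return (s ∷ ss) f))

  -- Says that the law of the trajectory has total mass 1. It lets the 1 counted for the current
  -- state be pulled out of the expectation in the first-step recursion.
  𝔼-trajectory-const : ∀ N s c → 𝔼 (trajectory d a N s) (λ _ → c) ≡ c
  𝔼-trajectory-const zero    s c = 𝔼-return {A = Vec State 0} [] (λ _ → c)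
  𝔼-trajectory-const (suc N) s c = trans (𝔼-trajectory-suc N s _)
    (trans (𝔼-cong (step d a s) λ s′ → 𝔼-trajectory-const N s′ c) (𝔼-step-const s c))

  𝔼-hittingTime : ℕ → State → ℚ
  𝔼-hittingTime N s = 𝔼 (trajectory d a N s) λ ss → fromℕ (hittingTime d ss)

  𝔼-hittingTime-absorbing : ∀ N s → Absorbing d s → 𝔼-hittingTime N s ≡ 0ℚ
  𝔼-hittingTime-absorbing zero    s ab = refl
  𝔼-hittingTime-absorbing (suc N) s ab = trans (𝔼-trajectory-suc N s _)
    (trans (𝔼-cong (step d a s) λ s′ → trans (𝔼-cong (trajectory d a N s′) hit≡0)
      (𝔼-trajectory-const N s′ 0ℚ)) (𝔼-step-const s 0ℚ))
    where
    hit≡0 : ∀ ss → fromℕ (hittingTime d (s ∷ ss)) ≡ 0ℚ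
    hit≡0 ss with absorbing? d s
    ... | yes _   = refl
    ... | no  ¬ab = contradiction ab ¬ab

  𝔼-hittingTime-suc : ∀ N s → ¬ Absorbing d s →
    𝔼-hittingTime (suc N) s ≡ 1ℚ ℚ.+ 𝔼 (step d a s) (𝔼-hittingTime N)
  𝔼-hittingTime-suc N s ¬ab = begin
    𝔼-hittingTime (suc N) s
      ≡⟨ 𝔼-trajectory-suc N s _ ⟩
    𝔼 (step d a s) (λ s′ → 𝔼 (trajectory d a N s′) λ ss → fromℕ (hittingTime d (s ∷ ss)))
      ≡⟨ 𝔼-cong (step d a s) (λ s′ → trans (𝔼-cong (trajectory d a N s′) hit-suc)
           (trans (𝔼-+ (trajectory d a N s′) (λ _ → 1ℚ) _)
                  (cong (ℚ._+ 𝔼-hittingTime N s′) (𝔼-trajectory-const N s′ 1ℚ)))) ⟩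
    𝔼 (step d a s) (λ s′ → 1ℚ ℚ.+ 𝔼-hittingTime N s′)
      ≡⟨ trans (𝔼-+ (step d a s) (λ _ → 1ℚ) (𝔼-hittingTime N))
               (cong (ℚ._+ 𝔼 (step d a s) (𝔼-hittingTime N)) (𝔼-step-const s 1ℚ)) ⟩
    1ℚ ℚ.+ 𝔼 (step d a s) (𝔼-hittingTime N) ∎
    where
    open ≡-Reasoning
    hit-suc : ∀ ss → fromℕ (hittingTime d (s ∷ ss)) ≡ 1ℚ ℚ.+ fromℕ (hittingTime d ss)
    hit-suc ss with absorbing? d s
    ... | yes ab = contradiction ab ¬ab
    ... | no  _  = ι-+ (+ 1) (+ hittingTime d ss)

  -- Induction on N by first-step analysis: the current step costs m, the induction hypothesis
  -- bounds the rest by V at the next state, and the drift condition pays for both. Only the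
  -- truncated times min(T , N) enter, so no limit is taken here.
  foster : n ≥ 1 → ∀ (m : ℚ) (V : State → ℚ) →
           (∀ {s} → IsState d n s → 0ℚ ℚ.≤ V s) →
           (∀ {s} → IsState d n s → ¬ Absorbing d s → m ℚ.+ 𝔼 (step d a s) V ℚ.≤ V s) →
           ∀ N {s} → IsState d n s → m ℚ.* 𝔼-hittingTime N s ℚ.≤ V s
  foster n≥1 m V 0≤V drift zero {s} st =
    subst (ℚ._≤ V s) (sym (ℚ.*-zeroʳ m)) (0≤V st)
  foster n≥1 m V 0≤V drift (suc N) {s} st = bound (absorbing? d s)
    where
    open ℚ.≤-Reasoning
    bound : Dec (Absorbing d s) → m ℚ.* 𝔼-hittingTime (suc N) s ℚ.≤ V s
    bound (yes ab) = begin
      m ℚ.* 𝔼-hittingTime (suc N) s  ≡⟨ cong (m ℚ.*_) (𝔼-hittingTime-absorbing (suc N) s ab) ⟩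
      m ℚ.* 0ℚ                       ≡⟨ ℚ.*-zeroʳ m ⟩
      0ℚ                             ≤⟨ 0≤V st ⟩
      V s                            ∎
    bound (no ¬ab) = begin
      m ℚ.* 𝔼-hittingTime (suc N) s
        ≡⟨ cong (m ℚ.*_) (𝔼-hittingTime-suc N s ¬ab) ⟩
      m ℚ.* (1ℚ ℚ.+ 𝔼 (step d a s) (𝔼-hittingTime N))
        ≡⟨ ℚ.*-distribˡ-+ m 1ℚ _ ⟩
      m ℚ.* 1ℚ ℚ.+ m ℚ.* 𝔼 (step d a s) (𝔼-hittingTime N)
        ≡⟨ cong₂ ℚ._+_ (ℚ.*-identityʳ m) (sym (𝔼-* m (step d a s) (𝔼-hittingTime N))) ⟩
      m ℚ.+ 𝔼 (step d a s) (λ s′ → m ℚ.* 𝔼-hittingTime N s′)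
        ≤⟨ ℚ.+-monoʳ-≤ m (𝔼-mono (step-nonNeg s) (step-closed d a n≥1 st)
             (foster n≥1 m V 0≤V drift N)) ⟩
      m ℚ.+ 𝔼 (step d a s) V
        ≤⟨ drift st ¬ab ⟩
      V s ∎

-- The Lyapunov function

open ℤSolver.+-*-Solver

-- A predicate on syntax that computes: for a concrete admissible polynomial it reduces to a product
-- of copies of `⊤`, so its evidence can stay implicit. Subtraction unfolds to a negation and is
-- rejected.
NonNegCoeffs : ∀ {k} → Polynomial k → Set
NonNegCoeffs (op _ f g)     = NonNegCoeffs f × NonNegCoeffs g
NonNegCoeffs (con (+ _))    = ⊤
NonNegCoeffs (con -[1+ _ ]) = ⊥
NonNegCoeffs (var _)        = ⊤
NonNegCoeffs (f :^ _)       = NonNegCoeffs f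
NonNegCoeffs (:- _)         = ⊥

0≤i*j : ∀ {i j} → + 0 ℤ.≤ i → + 0 ℤ.≤ j → + 0 ℤ.≤ i ℤ.* j
0≤i*j {+ i} {+ j} _ _ = subst (+ 0 ℤ.≤_) (ℤ.pos-* i j) (+≤+ z≤n)

0≤i*i : ∀ i → + 0 ℤ.≤ i ℤ.* i
0≤i*i (+ i)    = 0≤i*j {+ i} {+ i} (+≤+ z≤n) (+≤+ z≤n)
0≤i*i -[1+ i ] = +≤+ z≤n

0≤i^k : ∀ {i} → + 0 ℤ.≤ i → ∀ k → + 0 ℤ.≤ i ^ k
0≤i^k 0≤i zero    = +≤+ z≤n
0≤i^k 0≤i (suc k) = 0≤i*j 0≤i (0≤i^k 0≤i k)

0≤⟦_⟧ : ∀ {k} (f : Polynomial k) {_ : NonNegCoeffs f} {ρ : Vec ℤ k} →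
        Allᵛ.All (+ 0 ℤ.≤_) ρ → + 0 ℤ.≤ ⟦ f ⟧ ρ
0≤⟦ op [+] f g ⟧ {nf , ng} 0≤ρ = ℤ.+-mono-≤ (0≤⟦ f ⟧ {nf} 0≤ρ) (0≤⟦ g ⟧ {ng} 0≤ρ)
0≤⟦ op [*] f g ⟧ {nf , ng} 0≤ρ = 0≤i*j (0≤⟦ f ⟧ {nf} 0≤ρ) (0≤⟦ g ⟧ {ng} 0≤ρ)
0≤⟦ con (+ _) ⟧            0≤ρ = +≤+ z≤n
0≤⟦ var i ⟧                0≤ρ = lookup⁺ 0≤ρ i
0≤⟦ f :^ k ⟧     {nf}      0≤ρ = 0≤i^k (0≤⟦ f ⟧ {nf} 0≤ρ) k

:1 :2 : ∀ {k} → Polynomial k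
:1 = con (+ 1)
:2 = con (+ 2)

sq : ∀ {k} → Polynomial k → Polynomial k
sq z = z :* z

shiftᴾ : ∀ {k} (n x y : Polynomial k) → Polynomial k
shiftᴾ n x y = x :- y :+ :2 :* n

-- A solver polynomial, so that solve can expand it at shifted arguments.
-- The summands are arranged to be nonnegative on the states.
lyapunovᴾ : ∀ {k} (n x y : Polynomial k) → Polynomial k
lyapunovᴾ n x y =
     (con (+ 3) :* n :- r) :* (r :^ 3 :+ n :* r :^ 2 :+ con (+ 10) :* n :^ 2 :* r :+ con (+ 38) :* n :^ 3)
  :+ con (+ 8) :* sq (r :- n)
  :+ (sq (n :- :2 :* r) :+ sq (n :- r) :+ sq r) :* sq p
  :+ (:2 :* n :- p) :* (:2 :* n :+ p) :* sq p
  where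
  p = x :+ y
  r = shiftᴾ n x y

lyapunov : (n x y : ℤ) → ℤ
lyapunov n x y = ⟦ lyapunovᴾ (var 0F) (var 1F) (var 2F) ⟧ (n ∷ x ∷ y ∷ [])

dropᴾ : ∀ {k} → Polynomial k → Polynomial k
dropᴾ n = :2 :* sq n

drop : ℤ → ℤ
drop n = ⟦ dropᴾ (var 0F) ⟧ (n ∷ [])

targetᴾ : ∀ {k} (n x y : Polynomial k) → Polynomial k
targetᴾ n x y = lyapunovᴾ n x y :- dropᴾ n

target : (n x y : ℤ) → ℤ
target n x y = lyapunov n x y ℤ.- drop n

-- Certificate for an inequality: j - i is exhibited as a polynomial with nonnegative coefficients
-- in nonnegative slacks, and the identity `eq` is left to the ring solver.
≤-fromSlack : ∀ {k} (f : Polynomial k) {_ : NonNegCoeffs f} {ρ : Vec ℤ k} {i j} →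
              ⟦ f ⟧ ρ ≡ j ℤ.- i → Allᵛ.All (+ 0 ℤ.≤_) ρ → i ℤ.≤ j
≤-fromSlack f {nf} eq 0≤ρ = ℤ.0≤i-j⇒j≤i (subst (+ 0 ℤ.≤_) eq (0≤⟦ f ⟧ {nf} 0≤ρ))

-- Twice the drop of V in excess of 2n² at the sides x = n, y = -n (awayᴾ)
-- and x = -n, y = n (towardᴾ), and the excess itself at the corners, written
-- in slack variables vanishing at the ends of the side (or at n = 1).
awayᴾ : ∀ {k} (t u : Polynomial k) → Polynomial k
awayᴾ t u =
     con (+ 136) :* t :^ 3 :+ con (+ 452) :* t :^ 2 :* u :+ con (+ 860) :* t :^ 2
  :+ con (+ 328) :* t :* u :^ 2 :+ con (+ 1560) :* t :* u :+ con (+ 1560) :* t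
  :+ con (+ 12) :* u :^ 3 :+ con (+ 364) :* u :^ 2 :+ con (+ 1096) :* u :+ con (+ 800)

towardᴾ : ∀ {k} (t u : Polynomial k) → Polynomial k
towardᴾ t u =
     :2 :* t :^ 3 :+ con (+ 19) :* t :^ 2 :* u :+ con (+ 25) :* t :^ 2
  :+ con (+ 20) :* t :* u :^ 2 :+ con (+ 78) :* t :* u :+ con (+ 72) :* t
  :+ con (+ 3) :* u :^ 3 :+ con (+ 29) :* u :^ 2 :+ con (+ 44) :* u :+ con (+ 28)

nearCornerᴾ : ∀ {k} (j : Polynomial k) → Polynomial k
nearCornerᴾ j = con (+ 80) :* j :^ 3 :+ con (+ 262) :* j :^ 2 :+ con (+ 220) :* j :+ con (+ 54)

farCornerᴾ : ∀ {k} (j : Polynomial k) → Polynomial k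
farCornerᴾ j = con (+ 16) :* j :^ 3 :+ con (+ 74) :* j :^ 2 :+ con (+ 116) :* j :+ con (+ 42)

-- Drift inequalities over ℤ: interior, sides and corners

module _ (n : ℤ) where

  -- Up to terms affine in r, V is -Re (r + ip)⁴ + 2n Re (r + ip)³ - 7n²r² + 6n²p² + 8r². One step
  -- changes the expectation of the quartic part by -16, of the cubic part by 0, and of r² and p² by
  -- 2 each. The 8r² cancels the -16, leaving -14n² + 12n² = -2n².
  interior : ∀ x y →
    (lyapunov n (x ℤ.+ + 1) (y ℤ.+ + 1) ℤ.+ lyapunov n (x ℤ.+ + 1) (y ℤ.- + 1)) ℤ.+
    (lyapunov n (x ℤ.- + 1) (y ℤ.+ + 1) ℤ.+ lyapunov n (x ℤ.- + 1) (y ℤ.- + 1)) ≡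
    + 2 ℤ.* (+ 2 ℤ.* target n x y)
  interior = solve 3 (λ n x y →
    (lyapunovᴾ n (x :+ :1) (y :+ :1) :+ lyapunovᴾ n (x :+ :1) (y :- :1)) :+
    (lyapunovᴾ n (x :- :1) (y :+ :1) :+ lyapunovᴾ n (x :- :1) (y :- :1)) :=
    :2 :* (:2 :* targetᴾ n x y)) refl n

  -- The forced move at x = n lowers x - y, away from absorption. The slacks are y - 1, nonnegative
  -- because x - y < n off the absorbing line, and n - 1 - y.
  right : ∀ {y} → + 0 ℤ.≤ n ℤ.- + 1 ℤ.- (n ℤ.- y) → + 0 ℤ.≤ n ℤ.- + 1 ℤ.- y →
          lyapunov n (n ℤ.- + 1) (y ℤ.+ + 1) ℤ.+ lyapunov n (n ℤ.- + 1) (y ℤ.- + 1) ℤ.≤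
          + 2 ℤ.* target n n y
  right {y} 0≤t 0≤u = ≤-fromSlack (awayᴾ (var 0F) (var 1F))
    (solve 2 (λ n y → awayᴾ (n :- :1 :- (n :- y)) (n :- :1 :- y) :=
      :2 :* targetᴾ n n y :-
      (lyapunovᴾ n (n :- :1) (y :+ :1) :+ lyapunovᴾ n (n :- :1) (y :- :1))) refl n y)
    (0≤t ∷ 0≤u ∷ [])

  -- Mirror image of `right` under (x , y) ↦ (-y , -x), which fixes r and negates p. V is even in p,
  -- so the same certificate serves; `left` and `top` are paired in the same way.
  bottom : ∀ {x} → + 0 ℤ.≤ n ℤ.- + 1 ℤ.- (x ℤ.- ℤ.- n) → + 0 ℤ.≤ x ℤ.- + 1 ℤ.- ℤ.- n →
           lyapunov n (x ℤ.+ + 1) (ℤ.- n ℤ.+ + 1) ℤ.+ lyapunov n (x ℤ.- + 1) (ℤ.- n ℤ.+ + 1) ℤ.≤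
           + 2 ℤ.* target n x (ℤ.- n)
  bottom {x} 0≤t 0≤u = ≤-fromSlack (awayᴾ (var 0F) (var 1F))
    (solve 2 (λ n x → awayᴾ (n :- :1 :- (x :- (:- n))) (x :- :1 :- (:- n)) :=
      :2 :* targetᴾ n x (:- n) :-
      (lyapunovᴾ n (x :+ :1) ((:- n) :+ :1) :+ lyapunovᴾ n (x :- :1) ((:- n) :+ :1))) refl n x)
    (0≤t ∷ 0≤u ∷ [])

  -- Here the forced move raises x - y, toward absorption, and the slacks measure the distance of y
  -- from both ends of the side.
  left : ∀ {y} → + 0 ℤ.≤ y ℤ.- + 1 ℤ.- ℤ.- n → + 0 ℤ.≤ n ℤ.- + 1 ℤ.- y →
         lyapunov n (ℤ.- n ℤ.+ + 1) (y ℤ.+ + 1) ℤ.+ lyapunov n (ℤ.- n ℤ.+ + 1) (y ℤ.- + 1) ℤ.≤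
         + 2 ℤ.* target n (ℤ.- n) y
  left {y} 0≤t 0≤u = ≤-fromSlack (towardᴾ (var 0F) (var 1F))
    (solve 2 (λ n y → towardᴾ (y :- :1 :- (:- n)) (n :- :1 :- y) :=
      :2 :* targetᴾ n (:- n) y :-
      (lyapunovᴾ n ((:- n) :+ :1) (y :+ :1) :+ lyapunovᴾ n ((:- n) :+ :1) (y :- :1))) refl n y)
    (0≤t ∷ 0≤u ∷ [])

  top : ∀ {x} → + 0 ℤ.≤ n ℤ.- + 1 ℤ.- x → + 0 ℤ.≤ x ℤ.- + 1 ℤ.- ℤ.- n →
        lyapunov n (x ℤ.+ + 1) (n ℤ.- + 1) ℤ.+ lyapunov n (x ℤ.- + 1) (n ℤ.- + 1) ℤ.≤
        + 2 ℤ.* target n x n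
  top {x} 0≤t 0≤u = ≤-fromSlack (towardᴾ (var 0F) (var 1F))
    (solve 2 (λ n x → towardᴾ (n :- :1 :- x) (x :- :1 :- (:- n)) :=
      :2 :* targetᴾ n x n :-
      (lyapunovᴾ n (x :+ :1) (n :- :1) :+ lyapunovᴾ n (x :- :1) (n :- :1))) refl n x)
    (0≤t ∷ 0≤u ∷ [])

  module _ (0≤n-1 : + 0 ℤ.≤ n ℤ.- + 1) where

    -- At a corner both moves are forced, so two values of V are compared directly. From (n , n) and
    -- (-n , -n) the move keeps r = 2n and shortens p; from (-n , n) it keeps p = 0 and raises r
    -- from 0 to 2.
    topRight : lyapunov n (n ℤ.- + 1) (n ℤ.- + 1) ℤ.≤ target n n n
    topRight = ≤-fromSlack (nearCornerᴾ (var 0F))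
      (solve 1 (λ n → nearCornerᴾ (n :- :1) :=
        targetᴾ n n n :- lyapunovᴾ n (n :- :1) (n :- :1)) refl n)
      (0≤n-1 ∷ [])

    bottomLeft : lyapunov n (ℤ.- n ℤ.+ + 1) (ℤ.- n ℤ.+ + 1) ℤ.≤ target n (ℤ.- n) (ℤ.- n)
    bottomLeft = ≤-fromSlack (nearCornerᴾ (var 0F))
      (solve 1 (λ n → nearCornerᴾ (n :- :1) :=
        targetᴾ n (:- n) (:- n) :- lyapunovᴾ n ((:- n) :+ :1) ((:- n) :+ :1)) refl n)
      (0≤n-1 ∷ [])

    topLeft : lyapunov n (ℤ.- n ℤ.+ + 1) (n ℤ.- + 1) ℤ.≤ target n (ℤ.- n) n
    topLeft = ≤-fromSlack (farCornerᴾ (var 0F))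
      (solve 1 (λ n → farCornerᴾ (n :- :1) :=
        targetᴾ n (:- n) n :- lyapunovᴾ n ((:- n) :+ :1) (n :- :1)) refl n)
      (0≤n-1 ∷ [])

-- Source of the constant: for n = 2d, V(0,0) / 2n² = 35n² + 4 = 140d² + 4, which is at most 144d²
-- when d ≥ 1. The certificate is 32d²(d² - 1) written in d - 1.
origin : ∀ d → + 0 ℤ.≤ d ℤ.- + 1 →
         lyapunov (+ 2 ℤ.* d) (+ 0) (+ 0) ℤ.≤ drop (+ 2 ℤ.* d) ℤ.* (+ 144 ℤ.* (d ℤ.* d))
origin d 0≤d-1 = ≤-fromSlack (con (+ 32) :* sq (var 0F :+ :1) :* (var 0F :* (var 0F :+ :2)))
  (solve 1 (λ d → con (+ 32) :* sq (d :- :1 :+ :1) :* ((d :- :1) :* (d :- :1 :+ :2)) :=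
    dropᴾ (:2 :* d) :* (con (+ 144) :* sq d) :- lyapunovᴾ (:2 :* d) (con (+ 0)) (con (+ 0))) refl d)
  (0≤d-1 ∷ [])

0≤lyapunov : ∀ {n x y} → ℤ.- n ℤ.≤ x → x ℤ.≤ n → ℤ.- n ℤ.≤ y → y ℤ.≤ n → x ℤ.- y ℤ.≤ n →
             + 0 ℤ.≤ n → + 0 ℤ.≤ lyapunov n x y
0≤lyapunov {n} {x} {y} -n≤x x≤n -n≤y y≤n x-y≤n 0≤n =
  -- The variables stand, in order, for 3n - r, r, n, 2n - p, 2n + p, and the squares of r - n, n -
  -- 2r, n - r, r and p. The squares are atoms because their bases may be negative.
  0≤⟦ var 0F :* (var 1F :^ 3 :+ var 2F :* var 1F :^ 2 :+ con (+ 10) :* var 2F :^ 2 :* var 1F :+ con (+ 38) :* var 2F :^ 3)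
      :+ con (+ 8) :* var 5F
      :+ (var 6F :+ var 7F :+ var 8F) :* var 9F
      :+ var 3F :* var 4F :* var 9F ⟧
    ( subst (+ 0 ℤ.≤_) (solve 3 (λ n x y → n :- (x :- y) := con (+ 3) :* n :- shiftᴾ n x y) refl n x y)
        (ℤ.i≤j⇒0≤j-i x-y≤n)
    ∷ subst (+ 0 ℤ.≤_) (solve 3 (λ n x y → (x :- (:- n)) :+ (n :- y) := shiftᴾ n x y) refl n x y)
        (ℤ.+-mono-≤ (ℤ.i≤j⇒0≤j-i -n≤x) (ℤ.i≤j⇒0≤j-i y≤n))
    ∷ 0≤n
    ∷ subst (+ 0 ℤ.≤_) (solve 3 (λ n x y → (n :- x) :+ (n :- y) := :2 :* n :- (x :+ y)) refl n x y)
        (ℤ.+-mono-≤ (ℤ.i≤j⇒0≤j-i x≤n) (ℤ.i≤j⇒0≤j-i y≤n))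
    ∷ subst (+ 0 ℤ.≤_) (solve 3 (λ n x y → (x :- (:- n)) :+ (y :- (:- n)) := :2 :* n :+ (x :+ y)) refl n x y)
        (ℤ.+-mono-≤ (ℤ.i≤j⇒0≤j-i -n≤x) (ℤ.i≤j⇒0≤j-i -n≤y))
    ∷ 0≤i*i (r ℤ.- n) ∷ 0≤i*i (n ℤ.- + 2 ℤ.* r) ∷ 0≤i*i (n ℤ.- r) ∷ 0≤i*i r ∷ 0≤i*i (x ℤ.+ y)
    ∷ [])
  where
  r = x ℤ.- y ℤ.+ + 2 ℤ.* n

-- The drift of the uniform chain

i<j⇒0≤j-1-i : ∀ {i j} → i ℤ.< j → + 0 ℤ.≤ j ℤ.- + 1 ℤ.- i
i<j⇒0≤j-1-i {i} {j} i<j =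
  ℤ.i≤j⇒0≤j-i (subst (i ℤ.≤_) (ℤ.+-comm ℤ.-1ℤ j) (ℤ.i<j⇒i≤pred[j] i<j))

-- The three cases correspond to the three values of the uniform bias: 0 at n, 1 at -n, and ½
-- strictly between.
data Position (n : ℤ) : ℤ → Set where
  atTop    : Position n n
  atBottom : Position n (ℤ.- n)
  inside   : ∀ {x} → ℤ.- n ℤ.< x → x ℤ.< n → Position n x

position : ∀ {n x} → ℤ.- n ℤ.≤ x → x ℤ.≤ n → Position n x
position {n} {x} -n≤x x≤n with x ℤ.≟ n | x ℤ.≟ ℤ.- n
... | yes refl | _        = atTop
... | no _     | yes refl = atBottom
... | no x≢n   | no x≢-n  = inside (ℤ.≤∧≢⇒< -n≤x (λ eq → x≢-n (sym eq))) (ℤ.≤∧≢⇒< x≤n x≢n)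

module _ (m : ℕ) where

  private
    a = uniform (suc m)
    n = + suc m

  coeff-uniform-½ : ∀ i → i ℕ.< suc m → coeff a i ≡ ½
  coeff-uniform-½ zero    _         = refl
  coeff-uniform-½ (suc i) (s≤s i<m) with i ℕ.<? m
  ... | yes _  = refl
  ... | no i≮m = contradiction i<m i≮m

  coeff-uniform-0 : coeff a (suc m) ≡ 0ℚ
  coeff-uniform-0 with m ℕ.<? m
  ... | yes m<m = contradiction m<m (ℕ.<-irrefl refl)
  ... | no  _   = refl

  bias-atTop : bias a n ≡ 0ℚ
  bias-atTop = coeff-uniform-0

  bias-atBottom : bias a (ℤ.- n) ≡ 1ℚ
  bias-atBottom = cong (λ p → 1ℚ ℚ.- p) coeff-uniform-0

  bias-inside : ∀ {x} → ℤ.- n ℤ.< x → x ℤ.< n → bias a x ≡ ½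
  bias-inside {+ i}       _         (+<+ i<n) = coeff-uniform-½ i i<n
  -- The integer `-[1+ i ]` is -(i + 1), with bias 1 - aᵢ₊₁. The lower bound gives i < m, that is i
  -- + 1 < n.
  bias-inside { -[1+ i ]} (-<- i<m) _         = cong (λ p → 1ℚ ℚ.- p) (coeff-uniform-½ (suc i) (s≤s i<m))

  V : ℤ → ℤ → ℚ
  V x y = ι (lyapunov n x y)

  𝔼-move² : ℤ → ℤ → ℚ
  𝔼-move² x y = 𝔼 (move a x) λ x′ → 𝔼 (move a y) λ y′ → V x′ y′

  -- The strict inequality is non-absorption when n = 2d. It supplies a slack on the sides x = n and
  -- y = -n, and it excludes the corner (n , -n).
  𝔼-move²-≤ : ∀ {x y} → Position n x → Position n y → x ℤ.- y ℤ.< n →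
              𝔼-move² x y ℚ.≤ ι (target n x y)
  𝔼-move²-≤ {x} {y} (inside -n<x x<n) (inside -n<y y<n) _ = begin
    𝔼-move² x y
      ≡⟨ 𝔼-move-½ a {x} (λ x′ → 𝔼 (move a y) (V x′)) (bias-inside -n<x x<n) ⟩
    ½ ℚ.* (𝔼 (move a y) (V x⁺) ℚ.+ 𝔼 (move a y) (V x⁻))
      ≡⟨ cong (½ ℚ.*_) (cong₂ ℚ._+_ (𝔼-move-½ a {y} (V x⁺) (bias-inside -n<y y<n))
                                    (𝔼-move-½ a {y} (V x⁻) (bias-inside -n<y y<n))) ⟩
    ½ ℚ.* (½ ℚ.* (V x⁺ y⁺ ℚ.+ V x⁺ y⁻) ℚ.+ ½ ℚ.* (V x⁻ y⁺ ℚ.+ V x⁻ y⁻))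
      ≤⟨ average₄ (lyapunov n x⁺ y⁺) (lyapunov n x⁺ y⁻) (lyapunov n x⁻ y⁺) (lyapunov n x⁻ y⁻)
           (ℤ.≤-reflexive (interior n x y)) ⟩
    ι (target n x y) ∎
    where
    open ℚ.≤-Reasoning
    x⁺ = x ℤ.+ + 1
    x⁻ = x ℤ.- + 1
    y⁺ = y ℤ.+ + 1
    y⁻ = y ℤ.- + 1
  𝔼-move²-≤ {y = y} atTop (inside -n<y y<n) n-y<n = begin
    𝔼-move² n y
      ≡⟨ 𝔼-move-0 a {n} (λ x′ → 𝔼 (move a y) (V x′)) bias-atTop ⟩
    𝔼 (move a y) (V n⁻)
      ≡⟨ 𝔼-move-½ a {y} (V n⁻) (bias-inside -n<y y<n) ⟩
    ½ ℚ.* (V n⁻ (y ℤ.+ + 1) ℚ.+ V n⁻ (y ℤ.- + 1))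
      ≤⟨ average₂ (lyapunov n n⁻ (y ℤ.+ + 1)) (lyapunov n n⁻ (y ℤ.- + 1))
           (right n {y} (i<j⇒0≤j-1-i n-y<n) (i<j⇒0≤j-1-i y<n)) ⟩
    ι (target n n y) ∎
    where
    open ℚ.≤-Reasoning
    n⁻ = n ℤ.- + 1
  𝔼-move²-≤ {y = y} atBottom (inside -n<y y<n) _ = begin
    𝔼-move² (ℤ.- n) y
      ≡⟨ 𝔼-move-1 a {ℤ.- n} (λ x′ → 𝔼 (move a y) (V x′)) bias-atBottom ⟩
    𝔼 (move a y) (V -n⁺)
      ≡⟨ 𝔼-move-½ a {y} (V -n⁺) (bias-inside -n<y y<n) ⟩
    ½ ℚ.* (V -n⁺ (y ℤ.+ + 1) ℚ.+ V -n⁺ (y ℤ.- + 1))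
      ≤⟨ average₂ (lyapunov n -n⁺ (y ℤ.+ + 1)) (lyapunov n -n⁺ (y ℤ.- + 1))
           (left n {y} (i<j⇒0≤j-1-i -n<y) (i<j⇒0≤j-1-i y<n)) ⟩
    ι (target n (ℤ.- n) y) ∎
    where
    open ℚ.≤-Reasoning
    -n⁺ = ℤ.- n ℤ.+ + 1
  𝔼-move²-≤ {x} (inside -n<x x<n) atTop _ = begin
    𝔼-move² x n
      ≡⟨ 𝔼-cong (move a x) (λ x′ → 𝔼-move-0 a {n} (V x′) bias-atTop) ⟩
    𝔼 (move a x) (λ x′ → V x′ n⁻)
      ≡⟨ 𝔼-move-½ a {x} (λ x′ → V x′ n⁻) (bias-inside -n<x x<n) ⟩
    ½ ℚ.* (V (x ℤ.+ + 1) n⁻ ℚ.+ V (x ℤ.- + 1) n⁻)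
      ≤⟨ average₂ (lyapunov n (x ℤ.+ + 1) n⁻) (lyapunov n (x ℤ.- + 1) n⁻)
           (top n {x} (i<j⇒0≤j-1-i x<n) (i<j⇒0≤j-1-i -n<x)) ⟩
    ι (target n x n) ∎
    where
    open ℚ.≤-Reasoning
    n⁻ = n ℤ.- + 1
  𝔼-move²-≤ {x} (inside -n<x x<n) atBottom x+n<n = begin
    𝔼-move² x (ℤ.- n)
      ≡⟨ 𝔼-cong (move a x) (λ x′ → 𝔼-move-1 a {ℤ.- n} (V x′) bias-atBottom) ⟩
    𝔼 (move a x) (λ x′ → V x′ -n⁺)
      ≡⟨ 𝔼-move-½ a {x} (λ x′ → V x′ -n⁺) (bias-inside -n<x x<n) ⟩
    ½ ℚ.* (V (x ℤ.+ + 1) -n⁺ ℚ.+ V (x ℤ.- + 1) -n⁺)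
      ≤⟨ average₂ (lyapunov n (x ℤ.+ + 1) -n⁺) (lyapunov n (x ℤ.- + 1) -n⁺)
           (bottom n {x} (i<j⇒0≤j-1-i x+n<n) (i<j⇒0≤j-1-i -n<x)) ⟩
    ι (target n x (ℤ.- n)) ∎
    where
    open ℚ.≤-Reasoning
    -n⁺ = ℤ.- n ℤ.+ + 1
  𝔼-move²-≤ atTop atTop _ = begin
    𝔼-move² n n
      ≡⟨ 𝔼-move-0 a {n} (λ x′ → 𝔼 (move a n) (V x′)) bias-atTop ⟩
    𝔼 (move a n) (V n⁻)
      ≡⟨ 𝔼-move-0 a {n} (V n⁻) bias-atTop ⟩
    V n⁻ n⁻
      ≤⟨ ι-mono-≤ (topRight n (+≤+ z≤n)) ⟩
    ι (target n n n) ∎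
    where
    open ℚ.≤-Reasoning
    n⁻ = n ℤ.- + 1
  𝔼-move²-≤ atBottom atTop _ = begin
    𝔼-move² (ℤ.- n) n
      ≡⟨ 𝔼-move-1 a {ℤ.- n} (λ x′ → 𝔼 (move a n) (V x′)) bias-atBottom ⟩
    𝔼 (move a n) (V -n⁺)
      ≡⟨ 𝔼-move-0 a {n} (V -n⁺) bias-atTop ⟩
    V -n⁺ (n ℤ.- + 1)
      ≤⟨ ι-mono-≤ (topLeft n (+≤+ z≤n)) ⟩
    ι (target n (ℤ.- n) n) ∎
    where
    open ℚ.≤-Reasoning
    -n⁺ = ℤ.- n ℤ.+ + 1
  𝔼-move²-≤ atBottom atBottom _ = begin
    𝔼-move² (ℤ.- n) (ℤ.- n)
      ≡⟨ 𝔼-move-1 a {ℤ.- n} (λ x′ → 𝔼 (move a (ℤ.- n)) (V x′)) bias-atBottom ⟩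
    𝔼 (move a (ℤ.- n)) (V -n⁺)
      ≡⟨ 𝔼-move-1 a {ℤ.- n} (V -n⁺) bias-atBottom ⟩
    V -n⁺ -n⁺
      ≤⟨ ι-mono-≤ (bottomLeft n (+≤+ z≤n)) ⟩
    ι (target n (ℤ.- n) (ℤ.- n)) ∎
    where
    open ℚ.≤-Reasoning
    -n⁺ = ℤ.- n ℤ.+ + 1
  𝔼-move²-≤ atTop atBottom n+n<n = contradiction n+n<n (ℤ.≤⇒≯ (ℤ.i≤i+j n n))

-- Foster's criterion at n = 2d and the bound from the origin

module _ (k : ℕ) where

  private
    d = suc k
    n = 2 * d
    a = uniform n
    W : State → ℤ
    W (x , y) = lyapunov (+ n) x y

  0≤ιW : ∀ {s} → IsState d n s → 0ℚ ℚ.≤ ι (W s)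
  0≤ιW (isState -n≤x x≤n -n≤y y≤n x-y≤n _) =
    ι-mono-≤ (0≤lyapunov -n≤x x≤n -n≤y y≤n x-y≤n (+≤+ z≤n))

  drift : ∀ {s} → IsState d n s → ¬ Absorbing d s →
          ι (drop (+ n)) ℚ.+ 𝔼 (step d a s) (λ s → ι (W s)) ℚ.≤ ι (W s)
  drift {s@(x , y)} (isState -n≤x x≤n -n≤y y≤n x-y≤n _) ¬ab = begin
    ι (drop (+ n)) ℚ.+ 𝔼 (step d a s) (λ s → ι (W s))
      ≡⟨ cong (ι (drop (+ n)) ℚ.+_) (𝔼-step d a {x} {y} ¬ab (λ s → ι (W s))) ⟩
    -- Since `2 * suc k` computes to a successor, `suc (pred n)` is `n` by definition.
    ι (drop (+ n)) ℚ.+ 𝔼-move² (ℕ.pred n) x y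
      ≤⟨ ℚ.+-monoʳ-≤ (ι (drop (+ n))) (𝔼-move²-≤ (ℕ.pred n)
           (position -n≤x x≤n) (position -n≤y y≤n) (ℤ.≤∧≢⇒< x-y≤n ¬ab)) ⟩
    ι (drop (+ n)) ℚ.+ ι (target (+ n) x y)
      ≡⟨ ι-+ (drop (+ n)) (target (+ n) x y) ⟨
    ι (drop (+ n) ℤ.+ target (+ n) x y)
      ≡⟨ cong ι (solve 2 (λ m v → m :+ (v :- m) := v) refl (drop (+ n)) (W s)) ⟩
    ι (W s) ∎
    where open ℚ.≤-Reasoning

  𝔼-hittingTime≤144d² : ∀ N → 𝔼-hittingTime d a N (+ 0 , + 0) ℚ.≤ ι (+ 144) ℚ.* fromℕ (d * d)
  -- Both sides are multiplied by 2n² > 0, which turns the claim into Foster's bound followed by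
  -- `origin`.
  𝔼-hittingTime≤144d² N = ℚ.*-cancelˡ-≤-pos (ι (drop (+ n))) {{ι-pos (drop (+ n))}} (begin
    ι (drop (+ n)) ℚ.* 𝔼-hittingTime d a N (+ 0 , + 0)
      ≤⟨ foster d a (s≤s z≤n) (ι (drop (+ n))) (λ s → ι (W s)) 0≤ιW drift N originIsState ⟩
    ι (lyapunov (+ n) (+ 0) (+ 0))
      ≤⟨ ι-mono-≤ (subst (λ n → lyapunov n (+ 0) (+ 0) ℤ.≤ drop n ℤ.* (+ 144 ℤ.* (+ d ℤ.* + d)))
           (sym (ℤ.pos-* 2 d)) (origin (+ d) (+≤+ z≤n))) ⟩
    ι (drop (+ n) ℤ.* (+ 144 ℤ.* + (d * d)))
      ≡⟨ ι-* (drop (+ n)) (+ 144 ℤ.* + (d * d)) ⟩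
    ι (drop (+ n)) ℚ.* ι (+ 144 ℤ.* + (d * d))
      ≡⟨ cong (ι (drop (+ n)) ℚ.*_) (ι-* (+ 144) (+ (d * d))) ⟩
    ι (drop (+ n)) ℚ.* (ι (+ 144) ℚ.* fromℕ (d * d)) ∎)
    where
    open ℚ.≤-Reasoning
    originIsState : IsState d n (+ 0 , + 0)
    originIsState = isState ℤ.neg-≤-pos (+≤+ z≤n) ℤ.neg-≤-pos (+≤+ z≤n) (+≤+ z≤n) (divides (+ 0) refl)

theorem4 : ∃[ C ] ((d : ℕ) → d ≥ 1 → U d (2 * d) (uniform (2 * d)) ≤ᴸ fromℚ (C ℚ.* fromℕ (d * d)))
-- A rational below the supremum lies below some 𝔼[min(T , N)], and the bound is uniform in N.
theorem4 = ι (+ 144) , λ { (suc k) _ q (N , q<𝔼) → ℚ.<-≤-trans q<𝔼 (𝔼-hittingTime≤144d² k N) }
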